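{- Let $G$ be an Eulerian graph. Then $p_{2,\mathrm{iso}}(G) = \mathrm{la}(G)$. Moreover, if $\mathrm{la}(G) \leq 2$, then $p_2(G) = \mathrm{la}(G)$.
   Context: All graphs are finite and simple. A graph is Eulerian if every vertex has even degree (it need not be connected). A path odd-cover of a graph $G=(V,E)$ is a collection of paths in the complete graph on $V$ whose edge sets have symmetric difference equal to $E$; $p_2(G)$ is the minimum cardinality of a path odd-cover of $G$. $p_{2,\mathrm{iso}}(G)$ is the minimum of $p_2(H)$ over all graphs $H$ obtained from $G$ by adding (any number, possibly zero, of) isolated vertices. A linear forest is a graph each of whose components is a path; the linear arboricity $\mathrm{la}(G)$ is the minimum number of edge-disjoint linear forests whose union is $E(G)$. -}

module Defs where

open import Data.Bool using (Bool; true; false; if_then_else_; _∧_; _∨_)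
open import Data.Nat using (ℕ; zero; suc; _+_; _≤_)
open import Data.Nat.Divisibility using (_∣_)
open import Data.Fin using (Fin; splitAt; _≟_)
open import Data.Sum using (inj₁; inj₂)
open import Data.List using (List; []; _∷_; length; filterᵇ; map; sum; allFin; concat)
open import Data.List.Relation.Unary.Unique.Propositional using (Unique)
open import Data.List.Relation.Unary.All using (All)
open import Data.List.Relation.Unary.AllPairs using (AllPairs)
open import Data.List.Membership.Propositional using (_∈_)
open import Data.Vec using (Vec; toList)
open import Data.Product using (Σ; ∃; _×_; _,_)
open import Relation.Nullary using (¬_; does)
open import Relation.Binary.PropositionalEquality using (_≡_; _≢_)

record Graph (n : ℕ) : Set where
  field
    adj   : Fin n → Fin n → Bool
    adj-sym : ∀ u v → adj u v ≡ adj v u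
    irref : ∀ u → adj u u ≡ false
open Graph public

degree : ∀ {n} → Graph n → Fin n → ℕ
degree G u = length (filterᵇ (adj G u) (allFin _))

-- Eulerian: every vertex has even degree (connectivity not required)
Eulerian : ∀ {n} → Graph n → Set
Eulerian {n} G = ∀ (u : Fin n) → 2 ∣ degree G u

-- Paths in the complete graph K_V: sequences of distinct vertices.
-- The edges of a path are the pairs of consecutive vertices.

record Path (n : ℕ) : Set where
  constructor mkPath
  field
    verts    : List (Fin n)
    distinct : Unique verts
open Path public

eqᵇ : ∀ {n} → Fin n → Fin n → Bool
eqᵇ a b = does (a ≟ b)

usesEdgeL : ∀ {n} → Fin n → Fin n → List (Fin n) → Bool
usesEdgeL u v []           = false
usesEdgeL u v (a ∷ [])     = false
usesEdgeL u v (a ∷ b ∷ xs) =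
  ((eqᵇ a u ∧ eqᵇ b v) ∨ (eqᵇ a v ∧ eqᵇ b u)) ∨ usesEdgeL u v (b ∷ xs)

usesEdge : ∀ {n} → Fin n → Fin n → Path n → Bool
usesEdge u v p = usesEdgeL u v (verts p)

edgeMult : ∀ {n} → Fin n → Fin n → List (Path n) → ℕ
edgeMult u v ps = length (filterᵇ (usesEdge u v) ps)

oddᵇ : ℕ → Bool
oddᵇ zero    = false
oddᵇ (suc k) = if oddᵇ k then false else true

IsPathOddCover : ∀ {n} → Graph n → List (Path n) → Set
IsPathOddCover {n} G ps =
  ∀ (u v : Fin n) → u ≢ v → oddᵇ (edgeMult u v ps) ≡ adj G u v

HasPathOddCoverOfSize : ∀ {n} → Graph n → ℕ → Set
HasPathOddCoverOfSize G k = Σ (List (Path _)) λ ps → length ps ≡ k × IsPathOddCover G ps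

P2Is : ∀ {n} → Graph n → ℕ → Set
P2Is G k = HasPathOddCoverOfSize G k × (∀ j → HasPathOddCoverOfSize G j → k ≤ j)

addIsolated : ∀ {n} → Graph n → (m : ℕ) → Graph (n + m)
addIsolated {n} G m = record { adj = a ; adj-sym = s ; irref = r }
  where
  a : Fin (n + m) → Fin (n + m) → Bool
  a i j with splitAt n i | splitAt n j
  ... | inj₁ x | inj₁ y = adj G x y
  ... | inj₁ _ | inj₂ _ = false
  ... | inj₂ _ | inj₁ _ = false
  ... | inj₂ _ | inj₂ _ = false
  s : ∀ u v → a u v ≡ a v u
  s i j with splitAt n i | splitAt n j
  ... | inj₁ x | inj₁ y = adj-sym G x y
  ... | inj₁ _ | inj₂ _ = _≡_.refl
  ... | inj₂ _ | inj₁ _ = _≡_.refl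
  ... | inj₂ _ | inj₂ _ = _≡_.refl
  r : ∀ u → a u u ≡ false
  r i with splitAt n i
  ... | inj₁ x = irref G x
  ... | inj₂ _ = _≡_.refl

P2IsoIs : ∀ {n} → Graph n → ℕ → Set
P2IsoIs G k =
  (∃ λ m → HasPathOddCoverOfSize (addIsolated G m) k) ×
  (∀ m j → HasPathOddCoverOfSize (addIsolated G m) j → k ≤ j)

VertexDisjoint : ∀ {n} → Path n → Path n → Set
VertexDisjoint p q = ∀ x → x ∈ verts p → ¬ (x ∈ verts q)

-- A linear forest (on vertex set Fin n) given by its non-trivial components,
-- each a path; components are pairwise vertex-disjoint.  Its edge set is the
-- union of the paths' edge sets.
record LinearForest (n : ℕ) : Set where
  constructor mkLF
  field
    comps    : List (Path n)
    disjoint : AllPairs VertexDisjoint comps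
open LinearForest public

IsLinearForestDecomposition : ∀ {n} → Graph n → ∀ {k} → Vec (LinearForest n) k → Set
IsLinearForestDecomposition {n} G fs =
  ∀ (u v : Fin n) → u ≢ v →
    edgeMult u v (concat (map comps (toList fs))) ≡ (if adj G u v then 1 else 0)

HasLinearForestDecomposition : ∀ {n} → Graph n → ℕ → Set
HasLinearForestDecomposition G k =
  Σ (Vec (LinearForest _) k) λ fs → IsLinearForestDecomposition G fs

LaIs : ∀ {n} → Graph n → ℕ → Set
LaIs G k = HasLinearForestDecomposition G k × (∀ j → HasLinearForestDecomposition G j → k ≤ j)

module Submission where

-- Upper bound. Since G is Eulerian, every vertex is an end of components in an even number of the
-- linear forests, and this stays true whenever edges are added to them in cancelling pairs. If a
-- forest F has two components, with an end a of one and the ends b, b′ of the other, then a is also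
-- an end in another forest F₁. If b (or b′) is an end in a third forest F₂, add a - w - b to F,
-- a - w to F₁ and b - w to F₂ for a new vertex w. Otherwise a, b, b′ are all ends in F₁, so in F₁
-- one of b, b′, say b, is in another component than a, and the edge ab can be added to both F and F₁.
-- The number of components drops each time, and with two forests no new vertex is ever needed.
--
-- Lower bound. Keeping every edge of G in the last path of the cover that uses it cuts the paths
-- into linear forests.

open import Defs
open import Data.Bool using (Bool; true; false; _∧_; _∨_; _xor_; not; if_then_else_)
open import Data.Bool.ListAction using (any)
import Data.Bool.Properties as Bool
open import Data.Bool.Solver using (module xor-∧-Solver)
open import Data.Empty using (⊥; ⊥-elim)
open import Data.Fin as Fin using (Fin; zero; suc; toℕ; fromℕ<)
import Data.Fin.Properties as Fin
open import Data.List using (List; []; _∷_; [_]; _++_; length; map; reverse; concat; concatMap; catMaybes; filterᵇ; tabulate; allFin)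
import Data.List.Properties as List
open import Data.List.Membership.Propositional using (_∈_)
open import Data.List.Membership.Propositional.Properties using (∈-++⁺ˡ; ∈-++⁺ʳ; ∈-concat⁺′)
open import Data.List.Relation.Binary.Permutation.Propositional as Perm using (_↭_; prep; ↭-sym; ↭-trans; ↭⇒↭ₛ)
import Data.List.Relation.Binary.Permutation.Propositional.Properties as Perm
import Data.List.Relation.Binary.Permutation.Setoid.Properties as PermSetoid
open import Data.List.Relation.Binary.Sublist.Propositional using (_⊆_; []; _∷_; _∷ʳ_; ⊆-refl)
import Data.List.Relation.Binary.Sublist.Propositional.Properties as Sublist
open import Data.List.Relation.Unary.All as All using (All; []; _∷_)
import Data.List.Relation.Unary.All.Properties as All
open import Data.List.Relation.Unary.AllPairs as AllPairs using ([]; _∷_)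
import Data.List.Relation.Unary.AllPairs.Properties as AllPairs
open import Data.List.Relation.Unary.Any using (here; there)
open import Data.List.Relation.Unary.Unique.Propositional using (Unique)
import Data.List.Relation.Unary.Unique.Propositional.Properties as Unique
open import Data.Maybe using (Maybe; just; nothing)
open import Data.Maybe.Properties using (just-injective)
open import Data.Nat using (ℕ; zero; suc; _+_; _*_; _∸_; _≤_; _<_; z≤n; s≤s; _≡ᵇ_; _≟_; _≤?_)
open import Data.Nat.Divisibility using (_∣_; divides)
open import Data.Nat.ListAction using (sum)
open import Data.Nat.ListAction.Properties using (sum-↭)
import Data.Nat.Properties as ℕ
open import Data.Product using (Σ; ∃; _×_; _,_; proj₁; proj₂)
open import Data.Sum using (_⊎_; inj₁; inj₂; isInj₁)
open import Data.Vec using (Vec; []; _∷_; toList)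
import Data.Vec.Properties as Vec
open import Function using (_∘_)
open import Relation.Binary.PropositionalEquality using (_≡_; _≢_; refl; sym; trans; cong; cong₂; subst; setoid; module ≡-Reasoning)
open import Relation.Nullary using (¬_; yes; no)
open import Relation.Nullary.Decidable using (dec-true; dec-false)

infix 4 _≈_ _≃_ _FlipsTo_

private
  variable
    A : Set
    n N : ℕ

-- Parities of sums over lists and initial segments of ℕ

⨁ : (A → Bool) → List A → Bool
⨁ f []       = false
⨁ f (x ∷ xs) = f x xor ⨁ f xs

⨁-cong : {f g : A → Bool} → (∀ x → f x ≡ g x) → ∀ xs → ⨁ f xs ≡ ⨁ g xs
⨁-cong f≗g []       = refl
⨁-cong f≗g (x ∷ xs) = cong₂ _xor_ (f≗g x) (⨁-cong f≗g xs)

⨁-++ : (f : A → Bool) → ∀ xs ys → ⨁ f (xs ++ ys) ≡ ⨁ f xs xor ⨁ f ys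
⨁-++ f []       ys = refl
⨁-++ f (x ∷ xs) ys =
  trans (cong (f x xor_) (⨁-++ f xs ys)) (sym (Bool.xor-assoc (f x) _ _))

xor-left-comm : ∀ x y z → x xor (y xor z) ≡ y xor (x xor z)
xor-left-comm = solve 3 (λ x y z → x :+ (y :+ z) := y :+ (x :+ z)) refl
  where open xor-∧-Solver

⨁-↭ : (f : A → Bool) → ∀ {xs ys} → xs ↭ ys → ⨁ f xs ≡ ⨁ f ys
⨁-↭ f Perm.refl         = refl
⨁-↭ f (prep x p)        = cong (f x xor_) (⨁-↭ f p)
⨁-↭ f (Perm.swap x y p) =
  trans (xor-left-comm (f x) (f y) _) (cong (λ b → f y xor (f x xor b)) (⨁-↭ f p))
⨁-↭ f (Perm.trans p q)  = trans (⨁-↭ f p) (⨁-↭ f q)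

⨁-pick : (f : A → Bool) → ∀ xs → ⨁ f xs ≡ true →
         Σ A λ y → Σ (List A) λ ys → xs ↭ y ∷ ys × f y ≡ true
⨁-pick f (x ∷ xs) odd with f x in fx
... | true  = x , xs , Perm.refl , fx
... | false with y , ys , p , fy ← ⨁-pick f xs odd =
  y , x ∷ ys , ↭-trans (prep x p) (Perm.swap x y Perm.refl) , fy

-- Chains will have natural numbers below a bound as vertices, so sums over all vertices run over
-- initial segments; a new vertex then raises the bound without renaming the old ones.
⨁< : ℕ → (ℕ → Bool) → Bool
⨁< zero    f = false
⨁< (suc n) f = f 0 xor ⨁< n (f ∘ suc)

⨁<-cong : ∀ n {f g} → (∀ u → f u ≡ g u) → ⨁< n f ≡ ⨁< n g
⨁<-cong zero    f≗g = refl
⨁<-cong (suc n) f≗g = cong₂ _xor_ (f≗g 0) (⨁<-cong n (f≗g ∘ suc))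

⨁<-false : ∀ n → ⨁< n (λ _ → false) ≡ false
⨁<-false zero    = refl
⨁<-false (suc n) = ⨁<-false n

xor-interchange : ∀ w x y z → (w xor x) xor (y xor z) ≡ (w xor y) xor (x xor z)
xor-interchange = solve 4 (λ w x y z → (w :+ x) :+ (y :+ z) := (w :+ y) :+ (x :+ z)) refl
  where open xor-∧-Solver

⨁<-xor : ∀ n f g → ⨁< n (λ u → f u xor g u) ≡ ⨁< n f xor ⨁< n g
⨁<-xor zero    f g = refl
⨁<-xor (suc n) f g =
  trans (cong ((f 0 xor g 0) xor_) (⨁<-xor n (f ∘ suc) (g ∘ suc))) (xor-interchange (f 0) (g 0) _ _)

⨁<-⨁ : ∀ n (φ : A → ℕ → Bool) xs →
        ⨁< n (λ u → ⨁ (λ x → φ x u) xs) ≡ ⨁ (λ x → ⨁< n (φ x)) xs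
⨁<-⨁ n φ []       = ⨁<-false n
⨁<-⨁ n φ (x ∷ xs) = trans (⨁<-xor n (φ x) _) (cong (⨁< n (φ x) xor_) (⨁<-⨁ n φ xs))

⨁<-indicator : ∀ {n a} → a < n → ∀ b → ⨁< n (λ u → (a ≡ᵇ u) ∧ b) ≡ b
⨁<-indicator {suc n} {zero}  a<n       b = trans (cong (b xor_) (⨁<-false n)) (Bool.xor-identityʳ b)
⨁<-indicator {suc n} {suc a} (s≤s a<n) b = ⨁<-indicator a<n b

⨁<-support : ∀ {n N} f → n ≤ N → (∀ u → n ≤ u → f u ≡ false) → ⨁< N f ≡ ⨁< n f
⨁<-support {zero}  {N}     f n≤N       zero-above =
  trans (⨁<-cong N (λ u → zero-above u z≤n)) (⨁<-false N)
⨁<-support {suc n} {suc N} f (s≤s n≤N) zero-above =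
  cong (f 0 xor_) (⨁<-support (f ∘ suc) n≤N (λ u n≤u → zero-above (suc u) (s≤s n≤u)))

≢⇒≡ᵇ-false : ∀ {a b} → a ≢ b → (a ≡ᵇ b) ≡ false
≢⇒≡ᵇ-false {a} {b} a≢b = dec-false (a ≟ b) a≢b

≡ᵇ-refl : ∀ a → (a ≡ᵇ a) ≡ true
≡ᵇ-refl a = dec-true (a ≟ a) refl

≡ᵇ-true⇒≡ : ∀ {a b} → (a ≡ᵇ b) ≡ true → a ≡ b
≡ᵇ-true⇒≡ {a} {b} eq with a ≟ b
... | yes a≡b = a≡b
... | no  a≢b with () ← trans (sym eq) (≢⇒≡ᵇ-false a≢b)

-- Chains and forests

-- With `xor` in place of a disjunction, edge sets become vectors over the field with two elements.
-- The two conjunctions cannot both hold if `a` and `b` differ, and on the diagonal they cancel.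
edge : ℕ → ℕ → ℕ → ℕ → Bool
edge a b u v = ((a ≡ᵇ u) ∧ (b ≡ᵇ v)) xor ((a ≡ᵇ v) ∧ (b ≡ᵇ u))

edge-flip : ∀ a b u v → edge a b u v ≡ edge b a u v
edge-flip a b u v = begin
  ((a ≡ᵇ u) ∧ (b ≡ᵇ v)) xor ((a ≡ᵇ v) ∧ (b ≡ᵇ u)) ≡⟨ Bool.xor-comm ((a ≡ᵇ u) ∧ (b ≡ᵇ v)) _ ⟩
  ((a ≡ᵇ v) ∧ (b ≡ᵇ u)) xor ((a ≡ᵇ u) ∧ (b ≡ᵇ v)) ≡⟨ cong₂ _xor_ (Bool.∧-comm (a ≡ᵇ v) _) (Bool.∧-comm (a ≡ᵇ u) _) ⟩
  edge b a u v ∎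
  where open ≡-Reasoning

edge-sym : ∀ a b u v → edge a b u v ≡ edge a b v u
edge-sym a b u v = Bool.xor-comm ((a ≡ᵇ u) ∧ (b ≡ᵇ v)) _

edge-≢ : ∀ {a b u v} → a ≢ u → b ≢ u → edge a b u v ≡ false
edge-≢ {a} {b} {u} {v} a≢u b≢u
  rewrite ≢⇒≡ᵇ-false a≢u | ≢⇒≡ᵇ-false b≢u = Bool.∧-zeroʳ (a ≡ᵇ v)

walk : ℕ → List ℕ → ℕ → ℕ → ℕ → Bool
walk a []      b u v = edge a b u v
walk a (x ∷ m) b u v = edge a x u v xor walk x m b u v

walk-++ : ∀ a m x m′ b u v → walk a (m ++ x ∷ m′) b u v ≡ walk a m x u v xor walk x m′ b u v
walk-++ a []      x m′ b u v = refl
walk-++ a (y ∷ m) x m′ b u v =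
  trans (cong (edge a y u v xor_) (walk-++ y m x m′ b u v)) (sym (Bool.xor-assoc (edge a y u v) _ _))

walk-sym : ∀ a m b u v → walk a m b u v ≡ walk a m b v u
walk-sym a []      b u v = edge-sym a b u v
walk-sym a (x ∷ m) b u v = cong₂ _xor_ (edge-sym a x u v) (walk-sym x m b u v)

walk-reverse : ∀ a m b u v → walk b (reverse m) a u v ≡ walk a m b u v
walk-reverse a []      b u v = edge-flip b a u v
walk-reverse a (x ∷ m) b u v = begin
  walk b (reverse (x ∷ m)) a u v                  ≡⟨ cong (λ l → walk b l a u v) (List.unfold-reverse x m) ⟩
  walk b (reverse m ++ x ∷ []) a u v              ≡⟨ walk-++ b (reverse m) x [] a u v ⟩
  walk b (reverse m) x u v xor edge x a u v       ≡⟨ cong₂ _xor_ (walk-reverse x m b u v) (edge-flip x a u v) ⟩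
  walk x m b u v xor edge a x u v                 ≡⟨ Bool.xor-comm (walk x m b u v) _ ⟩
  edge a x u v xor walk x m b u v                 ∎
  where open ≡-Reasoning

walk-∉ : ∀ {a m b u} v → All (_≢ u) (a ∷ m ++ [ b ]) → walk a m b u v ≡ false
walk-∉ {m = []}    v (a≢u ∷ b≢u ∷ []) = edge-≢ {v = v} a≢u b≢u
walk-∉ {m = x ∷ m} v (a≢u ∷ x≢u ∷ ≢u)
  rewrite edge-≢ {v = v} a≢u x≢u = walk-∉ v (x≢u ∷ ≢u)

⨁<-edge : ∀ {a b} → a < N → b < N → ∀ v → ⨁< N (λ u → edge a b u v) ≡ (a ≡ᵇ v) xor (b ≡ᵇ v)
⨁<-edge {N} {a} {b} a<N b<N v = begin
  ⨁< N (λ u → edge a b u v)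
    ≡⟨ ⨁<-xor N (λ u → (a ≡ᵇ u) ∧ (b ≡ᵇ v)) (λ u → (a ≡ᵇ v) ∧ (b ≡ᵇ u)) ⟩
  ⨁< N (λ u → (a ≡ᵇ u) ∧ (b ≡ᵇ v)) xor ⨁< N (λ u → (a ≡ᵇ v) ∧ (b ≡ᵇ u))
    ≡⟨ cong₂ _xor_ (⨁<-indicator a<N (b ≡ᵇ v))
         (trans (⨁<-cong N (λ u → Bool.∧-comm (a ≡ᵇ v) (b ≡ᵇ u))) (⨁<-indicator b<N (a ≡ᵇ v))) ⟩
  (b ≡ᵇ v) xor (a ≡ᵇ v) ≡⟨ Bool.xor-comm (b ≡ᵇ v) _ ⟩
  (a ≡ᵇ v) xor (b ≡ᵇ v) ∎
  where open ≡-Reasoning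

xor-telescope : ∀ x y z → (x xor y) xor (y xor z) ≡ x xor z
xor-telescope = solve 3 (λ x y z → (x :+ y) :+ (y :+ z) := x :+ z) refl
  where open xor-∧-Solver

-- The sum is the degree of `v` modulo 2. It telescopes: an inner vertex contributes to two
-- consecutive edges, and these contributions cancel.
⨁<-walk : ∀ {a m b} → All (_< N) (a ∷ m ++ [ b ]) → ∀ v →
          ⨁< N (λ u → walk a m b u v) ≡ (a ≡ᵇ v) xor (b ≡ᵇ v)
⨁<-walk {m = []}    (a<N ∷ b<N ∷ []) v = ⨁<-edge a<N b<N v
⨁<-walk {N} {a} {x ∷ m} {b} (a<N ∷ x<N ∷ <N) v = begin
  ⨁< N (λ u → edge a x u v xor walk x m b u v)
    ≡⟨ ⨁<-xor N (λ u → edge a x u v) _ ⟩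
  ⨁< N (λ u → edge a x u v) xor ⨁< N (λ u → walk x m b u v)
    ≡⟨ cong₂ _xor_ (⨁<-edge a<N x<N v) (⨁<-walk (x<N ∷ <N) v) ⟩
  ((a ≡ᵇ v) xor (x ≡ᵇ v)) xor ((x ≡ᵇ v) xor (b ≡ᵇ v))
    ≡⟨ xor-telescope (a ≡ᵇ v) (x ≡ᵇ v) (b ≡ᵇ v) ⟩
  (a ≡ᵇ v) xor (b ≡ᵇ v) ∎
  where open ≡-Reasoning

-- Start and end are separate fields, so a chain always has two ends to glue at; paths without edges
-- have no counterpart here.
record Chain : Set where
  constructor _⟨_⟩_
  field
    start : ℕ
    inner : List ℕ
    end   : ℕ
open Chain

vertices : Chain → List ℕ
vertices (a ⟨ m ⟩ b) = a ∷ m ++ [ b ]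

covers : Chain → ℕ → ℕ → Bool
covers (a ⟨ m ⟩ b) = walk a m b

ends : ℕ → Chain → Bool
ends v (a ⟨ m ⟩ b) = (a ≡ᵇ v) xor (b ≡ᵇ v)

flip : Chain → Chain
flip (a ⟨ m ⟩ b) = b ⟨ reverse m ⟩ a

extend : ℕ → Chain → Chain
extend w (a ⟨ m ⟩ b) = w ⟨ a ∷ m ⟩ b

-- The list `s` holds the vertices inserted at the joint: none when a single edge is added, one when
-- the connection runs through a new vertex.
glue : Chain → List ℕ → Chain → Chain
glue (a ⟨ m ⟩ b) s (c ⟨ m′ ⟩ d) = a ⟨ m ++ b ∷ s ++ c ∷ m′ ⟩ d

covers-flip : ∀ c u v → covers (flip c) u v ≡ covers c u v
covers-flip (a ⟨ m ⟩ b) = walk-reverse a m b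

covers-glue : ∀ c s d u v →
  covers (glue c s d) u v ≡ covers c u v xor (walk (end c) s (start d) u v xor covers d u v)
covers-glue (a ⟨ m ⟩ b) s (c ⟨ m′ ⟩ d) u v =
  trans (walk-++ a m b (s ++ c ∷ m′) d u v) (cong (walk a m b u v xor_) (walk-++ b s c m′ d u v))

vertices-flip : ∀ c → vertices (flip c) ↭ vertices c
vertices-flip (a ⟨ m ⟩ b) =
  ↭-trans (prep b (Perm.++⁺ʳ [ a ] (Perm.↭-reverse m)))
    (↭-trans (prep b (↭-sym (Perm.∷↭∷ʳ a m)))
      (↭-trans (Perm.swap b a Perm.refl) (prep a (Perm.∷↭∷ʳ b m))))

vertices-glue : ∀ c s d → vertices (glue c s d) ≡ vertices c ++ s ++ vertices d
vertices-glue (a ⟨ m ⟩ b) s (c ⟨ m′ ⟩ d) = cong (a ∷_) (begin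
  (m ++ b ∷ s ++ c ∷ m′) ++ [ d ]     ≡⟨ List.++-assoc m (b ∷ s ++ c ∷ m′) [ d ] ⟩
  m ++ b ∷ (s ++ c ∷ m′) ++ [ d ]     ≡⟨ cong (λ l → m ++ b ∷ l) (List.++-assoc s (c ∷ m′) [ d ]) ⟩
  m ++ [ b ] ++ s ++ c ∷ m′ ++ [ d ]  ≡⟨ List.++-assoc m [ b ] _ ⟨
  (m ++ [ b ]) ++ s ++ c ∷ m′ ++ [ d ] ∎)
  where open ≡-Reasoning

Forest : Set
Forest = List Chain

support : Forest → List ℕ
support = concatMap vertices

parity : ℕ → ℕ → Forest → Bool
parity u v = ⨁ (λ c → covers c u v)

endParity : ℕ → Forest → Bool
endParity v = ⨁ (ends v)

-- Uniqueness of the concatenated vertex lists says at once that every chain is a path and that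
-- distinct chains are disjoint.
record Valid (N : ℕ) (F : Forest) : Set where
  constructor valid
  field
    unique  : Unique (support F)
    bounded : All (_< N) (support F)
open Valid

Unique-resp-↭ : {xs ys : List A} → xs ↭ ys → Unique xs → Unique ys
Unique-resp-↭ p = PermSetoid.Unique-resp-↭ (setoid _) (↭⇒↭ₛ p)

Valid-resp-↭ : ∀ F F′ → support F ↭ support F′ → Valid N F → Valid N F′
Valid-resp-↭ _ _ p (valid un bd) = valid (Unique-resp-↭ p un) (Perm.All-resp-↭ p bd)

Valid-fresh : ∀ F F′ → N ∷ support F ↭ support F′ → Valid N F → Valid (suc N) F′
Valid-fresh _ _ p (valid un bd) = valid
  (Unique-resp-↭ p (All.map (λ x<N → ℕ.<⇒≢ x<N ∘ sym) bd ∷ un))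
  (Perm.All-resp-↭ p (ℕ.≤-refl ∷ All.map ℕ.m<n⇒m<1+n bd))

Valid-suc : ∀ F → Valid N F → Valid (suc N) F
Valid-suc _ (valid un bd) = valid un (All.map ℕ.m<n⇒m<1+n bd)

parity-sym : ∀ u v F → parity u v F ≡ parity v u F
parity-sym u v = ⨁-cong (λ { (a ⟨ m ⟩ b) → walk-sym a m b u v })

parity-∉ : ∀ {u} v F → All (_≢ u) (support F) → parity u v F ≡ false
parity-∉ v []      _  = refl
parity-∉ v (c ∷ F) ∉F
  rewrite walk-∉ {m = inner c} v (All.++⁻ˡ (vertices c) ∉F) = parity-∉ v F (All.++⁻ʳ (vertices c) ∉F)

-- This links degrees to ends: modulo 2, the degree of `v` in a forest counts the chains that end at
-- `v`.
⨁<-parity : ∀ F → All (_< N) (support F) → ∀ v → ⨁< N (λ u → parity u v F) ≡ endParity v F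
⨁<-parity {N} []      bd v = ⨁<-false N
⨁<-parity {N} (c ∷ F) bd v = trans (⨁<-xor N (λ u → covers c u v) _)
  (cong₂ _xor_ (⨁<-walk {m = inner c} (All.++⁻ˡ (vertices c) bd) v)
               (⨁<-parity F (All.++⁻ʳ (vertices c) bd) v))

endParity-∉ : ∀ v F → All (v ≢_) (support F) → endParity v F ≡ false
endParity-∉ v []                _        = refl
endParity-∉ v (c@(a ⟨ m ⟩ b) ∷ F) v∉
  with v≢a ∷ v∉m++b ← All.++⁻ˡ (vertices c) v∉
  with v≢b ∷ [] ← All.++⁻ʳ m v∉m++b
  rewrite ≢⇒≡ᵇ-false (v≢a ∘ sym) | ≢⇒≡ᵇ-false (v≢b ∘ sym)
  = endParity-∉ v F (All.++⁻ʳ (vertices c) v∉)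

start≢end : ∀ c F → Unique (support (c ∷ F)) → start c ≢ end c
start≢end (a ⟨ m ⟩ b) F (a∉ ∷ _) = All.lookup a∉ (∈-++⁺ˡ (∈-++⁺ʳ m (here refl)))

start≢start : ∀ c d F → Unique (support (c ∷ d ∷ F)) → start c ≢ start d
start≢start (a ⟨ m ⟩ b) d F (a∉ ∷ _) = All.lookup a∉ (∈-++⁺ʳ (m ++ [ b ]) (here refl))

-- By uniqueness the start of `c` is neither the other end of `c` nor a vertex of another chain, so
-- a single term survives.
endParity-start : ∀ c F → Unique (support (c ∷ F)) → endParity (start c) (c ∷ F) ≡ true
endParity-start c@(a ⟨ m ⟩ b) F un@(a∉ ∷ _)
  rewrite ≡ᵇ-refl a | ≢⇒≡ᵇ-false (start≢end c F un ∘ sym)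
        | endParity-∉ a F (All.++⁻ʳ (m ++ [ b ]) a∉) = refl

-- Rearrangements of forests and of families of forests

-- Carries the "without loss of generality" steps. It is used at two levels: on forests, with
-- reversal of a chain as `R`, and on families, with the resulting relation on forests as `R`. All
-- quantities of interest are invariant under both.
data Rearrange {A : Set} (R : A → A → Set) : List A → List A → Set where
  permute : ∀ {xs ys} → xs ↭ ys → Rearrange R xs ys
  replace : ∀ {x y xs} → R x y → Rearrange R (x ∷ xs) (y ∷ xs)
  under   : ∀ x {xs ys} → Rearrange R xs ys → Rearrange R (x ∷ xs) (x ∷ ys)
  then    : ∀ {xs ys zs} → Rearrange R xs ys → Rearrange R ys zs → Rearrange R xs zs

module _ {A : Set} {R : A → A → Set} where

  ⨁-rearrange : (f : A → Bool) → (∀ {x y} → R x y → f x ≡ f y) →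
                ∀ {xs ys} → Rearrange R xs ys → ⨁ f xs ≡ ⨁ f ys
  ⨁-rearrange f resp (permute p) = ⨁-↭ f p
  ⨁-rearrange f resp (replace {xs = xs} r) = cong (_xor ⨁ f xs) (resp r)
  ⨁-rearrange f resp (under x p) = cong (f x xor_) (⨁-rearrange f resp p)
  ⨁-rearrange f resp (then p q)  = trans (⨁-rearrange f resp p) (⨁-rearrange f resp q)

  length-rearrange : ∀ {xs ys} → Rearrange R xs ys → length xs ≡ length ys
  length-rearrange (permute p) = Perm.↭-length p
  length-rearrange (replace r) = refl
  length-rearrange (under x p) = cong suc (length-rearrange p)
  length-rearrange (then p q)  = trans (length-rearrange p) (length-rearrange q)

  All-rearrange : {P : A → Set} → (∀ {x y} → R x y → P x → P y) →
                  ∀ {xs ys} → Rearrange R xs ys → All P xs → All P ys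
  All-rearrange resp (permute p) pxs        = Perm.All-resp-↭ p pxs
  All-rearrange resp (replace r) (px ∷ pxs) = resp r px ∷ pxs
  All-rearrange resp (under x p) (px ∷ pxs) = px ∷ All-rearrange resp p pxs
  All-rearrange resp (then p q)  pxs        = All-rearrange resp q (All-rearrange resp p pxs)

_FlipsTo_ : Chain → Chain → Set
c FlipsTo d = d ≡ flip c

_≈_ : Forest → Forest → Set
_≈_ = Rearrange _FlipsTo_

concat-↭ : {xss yss : List (List A)} → xss ↭ yss → concat xss ↭ concat yss
concat-↭ Perm.refl           = Perm.refl
concat-↭ (prep xs p)         = Perm.++⁺ˡ xs (concat-↭ p)
concat-↭ (Perm.swap xs ys p) =
  ↭-trans (Perm.shifts xs ys) (Perm.++⁺ˡ ys (Perm.++⁺ˡ xs (concat-↭ p)))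
concat-↭ (Perm.trans p q)    = ↭-trans (concat-↭ p) (concat-↭ q)

support-≈ : ∀ {F F′} → F ≈ F′ → support F ↭ support F′
support-≈ (permute p)                  = concat-↭ (Perm.map⁺ vertices p)
support-≈ {c ∷ F} (replace refl)       = Perm.++⁺ʳ (support F) (↭-sym (vertices-flip c))
support-≈ (under c p)                  = Perm.++⁺ˡ (vertices c) (support-≈ p)
support-≈ (then p q)                   = ↭-trans (support-≈ p) (support-≈ q)

Valid-≈ : ∀ {F F′} → F ≈ F′ → Valid N F → Valid N F′
Valid-≈ {F = F} {F′} p = Valid-resp-↭ F F′ (support-≈ p)

unique-swap : ∀ c d F → Unique (support (c ∷ d ∷ F)) → Unique (support (d ∷ c ∷ F))
unique-swap c d F = Unique-resp-↭ (Perm.shifts (vertices c) (vertices d))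

parity-≈ : ∀ u v {F F′} → F ≈ F′ → parity u v F ≡ parity u v F′
parity-≈ u v = ⨁-rearrange _ (λ { {c} refl → sym (covers-flip c u v) })

-- An odd sum has a true term, which gives a chain ending at `v`; reversing it if necessary turns
-- `v` into its start.
exposeEnd : ∀ v F → endParity v F ≡ true → Σ Chain λ c → Σ Forest λ F′ → F ≈ c ∷ F′ × start c ≡ v
exposeEnd v F odd with ⨁-pick (ends v) F odd
... | c@(a ⟨ m ⟩ b) , F′ , p , cv with a ≟ v
...   | yes a≡v = c , F′ , permute p , a≡v
...   | no  a≢v = flip c , F′ , then (permute p) (replace refl) ,
                  ≡ᵇ-true⇒≡ (trans (cong (_xor (b ≡ᵇ v)) (sym (≢⇒≡ᵇ-false a≢v))) cv)

Family : Set
Family = List Forest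

_≃_ : Family → Family → Set
_≃_ = Rearrange _≈_

totalParity : ℕ → ℕ → Family → Bool
totalParity u v = ⨁ (parity u v)

size : Family → ℕ
size = sum ∘ map length

size-≃ : ∀ {Fs Fs′} → Fs ≃ Fs′ → size Fs ≡ size Fs′
size-≃ (permute p)            = sum-↭ (Perm.map⁺ length p)
size-≃ {F ∷ Fs} (replace r)   = cong (_+ size Fs) (length-rearrange r)
size-≃ (under F p)            = cong (length F +_) (size-≃ p)
size-≃ (then p q)             = trans (size-≃ p) (size-≃ q)

EndIn : ℕ → Family → Set
EndIn v Fs = Σ Chain λ c → Σ Forest λ F → Σ Family λ Fs′ → Fs ≃ (c ∷ F) ∷ Fs′ × start c ≡ v

exposeEndInFamily : ∀ v Fs → ⨁ (endParity v) Fs ≡ true → EndIn v Fs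
exposeEndInFamily v Fs odd
  with F , Fs′ , p , oddF ← ⨁-pick (endParity v) Fs odd
  with c , F′ , q , c≡v ← exposeEnd v F oddF
  = c , F′ , Fs′ , then (permute p) (replace q) , c≡v

-- Merging the components of the forests

-- Ends are always exposed as starts, so two chains have to be joined start to start. Reversing the
-- first one before `glue` achieves this.
vertices-glue-flip : ∀ c s d xs → s ++ vertices c ++ vertices d ++ xs ↭ vertices (glue (flip c) s d) ++ xs
vertices-glue-flip c s d xs = begin
  s ++ vertices c ++ vertices d ++ xs            ↭⟨ Perm.shifts s (vertices c) ⟩
  vertices c ++ s ++ vertices d ++ xs            ↭⟨ Perm.++⁺ʳ _ (vertices-flip c) ⟨
  vertices (flip c) ++ s ++ vertices d ++ xs     ≡⟨ cong (vertices (flip c) ++_) (List.++-assoc s (vertices d) xs) ⟨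
  vertices (flip c) ++ (s ++ vertices d) ++ xs   ≡⟨ List.++-assoc (vertices (flip c)) _ xs ⟨
  (vertices (flip c) ++ s ++ vertices d) ++ xs   ≡⟨ cong (_++ xs) (vertices-glue (flip c) s d) ⟨
  vertices (glue (flip c) s d) ++ xs             ∎
  where open Perm.PermutationReasoning

covers-glue-flip : ∀ c s d u v →
  covers (glue (flip c) s d) u v ≡ covers c u v xor (walk (start c) s (start d) u v xor covers d u v)
covers-glue-flip c s d u v =
  trans (covers-glue (flip c) s d u v) (cong (_xor (walk (start c) s (start d) u v xor covers d u v)) (covers-flip c u v))

flipSecond : ∀ c d cs Fs → (c ∷ d ∷ cs) ∷ Fs ≃ (c ∷ flip d ∷ cs) ∷ Fs
flipSecond c d cs Fs = replace (under c (replace refl))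

parity-glue-flip : ∀ c s d cs u v →
  parity u v (glue (flip c) s d ∷ cs) ≡ walk (start c) s (start d) u v xor parity u v (c ∷ d ∷ cs)
parity-glue-flip c s d cs u v =
  trans (cong (_xor parity u v cs) (covers-glue-flip c s d u v))
        (rearrange (covers c u v) (walk (start c) s (start d) u v) (covers d u v) (parity u v cs))
  where
  open xor-∧-Solver
  rearrange : ∀ x y z w → (x xor (y xor z)) xor w ≡ y xor (x xor (z xor w))
  rearrange = solve 4 (λ x y z w → (x :+ (y :+ z)) :+ w := y :+ (x :+ (z :+ w))) refl

-- Here `p` stands for an edge added to two forests.
xor-cancel₂ : ∀ p x y z → (p xor x) xor ((p xor y) xor z) ≡ x xor (y xor z)
xor-cancel₂ = solve 4 (λ p x y z → (p :+ x) :+ ((p :+ y) :+ z) := x :+ (y :+ z)) refl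
  where open xor-∧-Solver

-- Here `p` and `q` stand for the two edges at a new vertex: both are added to one forest, and each
-- to one further forest.
xor-cancel₃ : ∀ p q x y z w →
  ((p xor q) xor x) xor ((p xor y) xor ((q xor z) xor w)) ≡ x xor (y xor (z xor w))
xor-cancel₃ = solve 6 (λ p q x y z w →
  ((p :+ q) :+ x) :+ ((p :+ y) :+ ((q :+ z) :+ w)) := x :+ (y :+ (z :+ w))) refl
  where open xor-∧-Solver

-- The target parities `g` stay fixed while the vertex bound grows, so evenness of all degrees is
-- assumed for every bound from `n` on.
module Merging (g : ℕ → ℕ → Bool) (n : ℕ)
               (g-even : ∀ {N} → n ≤ N → ∀ v → ⨁< N (λ u → g u v) ≡ false) where

  record OddCover (N : ℕ) (Fs : Family) : Set where
    constructor oddCover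
    field
      valids   : All (Valid N) Fs
      parities : ∀ u v → totalParity u v Fs ≡ g u v
  open OddCover

  OddCover-≃ : ∀ {Fs Fs′} → Fs ≃ Fs′ → OddCover N Fs → OddCover N Fs′
  OddCover-≃ p (oddCover vs ps) = oddCover
    (All-rearrange Valid-≈ p vs)
    (λ u v → trans (sym (⨁-rearrange (parity u v) (parity-≈ u v) p)) (ps u v))

  -- Both sides compute the degree of `v` modulo 2: summing forest by forest gives the end parities,
  -- and summing over the target gives an even degree.
  endParities-even : ∀ {Fs} → n ≤ N → OddCover N Fs → ∀ v → ⨁ (endParity v) Fs ≡ false
  endParities-even {N} {Fs} n≤N (oddCover vs ps) v = begin
    ⨁ (endParity v) Fs                             ≡⟨ ⨁-endParity Fs vs ⟩
    ⨁ (λ F → ⨁< N (λ u → parity u v F)) Fs         ≡⟨ ⨁<-⨁ N (λ F u → parity u v F) Fs ⟨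
    ⨁< N (λ u → totalParity u v Fs)                ≡⟨ ⨁<-cong N (λ u → ps u v) ⟩
    ⨁< N (λ u → g u v)                             ≡⟨ g-even n≤N v ⟩
    false                                          ∎
    where
    open ≡-Reasoning
    ⨁-endParity : ∀ Fs → All (Valid N) Fs → ⨁ (endParity v) Fs ≡ ⨁ (λ F → ⨁< N (λ u → parity u v F)) Fs
    ⨁-endParity []       []       = refl
    ⨁-endParity (F ∷ Fs) (w ∷ ws) = cong₂ _xor_ (sym (⨁<-parity F (bounded w) v)) (⨁-endParity Fs ws)

  -- The measure is the total number of components. The field `bound-≡` records that at most two
  -- forests never require a new vertex, for the second half of the theorem.
  record Progress (N : ℕ) (Fs : Family) : Set where
    constructor progress
    field
      {bound}     : ℕ
      {family}    : Family
      cover       : OddCover bound family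
      same-length : length family ≡ length Fs
      decrease    : size family < size Fs
      bound-≤     : N ≤ bound
      bound-≡     : length Fs ≤ 2 → bound ≡ N

  Progress-≃ : ∀ {Fs Fs′} → Fs ≃ Fs′ → Progress N Fs′ → Progress N Fs
  Progress-≃ p (progress c l d b b≡) = progress c
    (trans l (sym (length-rearrange p))) (subst (_ <_) (sym (size-≃ p)) d) b
    (λ le → b≡ (subst (_≤ 2) (length-rearrange p) le))

  -- The first forest loses a component by receiving the path from `start c` through the new vertex
  -- `N` to `start d`. The other two only have a chain prolonged to `N`, by one edge of that path
  -- each, so all parities are preserved.
  glueThroughFresh : ∀ c d cs e es f fs Fs → start e ≡ start c → start f ≡ start d →
    let Fs₃ = (c ∷ d ∷ cs) ∷ (e ∷ es) ∷ (f ∷ fs) ∷ Fs in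
    OddCover N Fs₃ → Progress N Fs₃
  glueThroughFresh {N} c d cs e es f fs Fs refl refl (oddCover (v₁ ∷ v₂ ∷ v₃ ∷ vs) ps) = progress
    {family = (c′ ∷ cs) ∷ (e′ ∷ es) ∷ (f′ ∷ fs) ∷ Fs}
    (oddCover
      ( Valid-fresh (c ∷ d ∷ cs) (c′ ∷ cs) (vertices-glue-flip c [ N ] d (support cs)) v₁
      ∷ Valid-fresh (e ∷ es) (e′ ∷ es) Perm.refl v₂
      ∷ Valid-fresh (f ∷ fs) (f′ ∷ fs) Perm.refl v₃
      ∷ All.map (Valid-suc _) vs)
      (λ u v → trans (same-parity u v) (ps u v)))
    -- The number of components drops by exactly one. Three forests are present, so the claim about
    -- at most two is vacuous.
    refl ℕ.≤-refl (ℕ.n≤1+n N) (λ { (s≤s (s≤s ())) })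
    where
    c′ = glue (flip c) [ N ] d
    e′ = extend N e
    f′ = extend N f
    same-parity : ∀ u v →
      totalParity u v ((c′ ∷ cs) ∷ (e′ ∷ es) ∷ (f′ ∷ fs) ∷ Fs)
        ≡ totalParity u v ((c ∷ d ∷ cs) ∷ (e ∷ es) ∷ (f ∷ fs) ∷ Fs)
    same-parity u v = begin
      totalParity u v ((c′ ∷ cs) ∷ (e′ ∷ es) ∷ (f′ ∷ fs) ∷ Fs)
        ≡⟨ cong₂ _xor_ (parity-glue-flip c [ N ] d cs u v)
             (cong₂ _xor_ (parity-extend e es) (cong (_xor totalParity u v Fs) (parity-extend f fs))) ⟩
      ((p xor q) xor P) xor ((edge N a u v xor Q) xor ((q xor R) xor totalParity u v Fs))
        ≡⟨ cong (λ r → ((p xor q) xor P) xor ((r xor Q) xor ((q xor R) xor totalParity u v Fs)))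
             (edge-flip N a u v) ⟩
      ((p xor q) xor P) xor ((p xor Q) xor ((q xor R) xor totalParity u v Fs))
        ≡⟨ xor-cancel₃ p q P Q R (totalParity u v Fs) ⟩
      P xor (Q xor (R xor totalParity u v Fs)) ∎
      where
      open ≡-Reasoning
      a = start c
      p = edge a N u v
      q = edge N (start d) u v
      P = parity u v (c ∷ d ∷ cs)
      Q = parity u v (e ∷ es)
      R = parity u v (f ∷ fs)
      parity-extend : ∀ x xs →
        parity u v (extend N x ∷ xs) ≡ edge N (start x) u v xor parity u v (x ∷ xs)
      parity-extend x xs = Bool.xor-assoc (edge N (start x) u v) (covers x u v) (parity u v xs)

  -- In both forests the two shared ends lie on different components, so the same edge can be added
  -- to each without closing a cycle, and its two copies cancel.
  glueDirectly : ∀ c d cs e f fs Fs → start e ≡ start c → start f ≡ start d →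
    let Fs₂ = (c ∷ d ∷ cs) ∷ (e ∷ f ∷ fs) ∷ Fs in
    OddCover N Fs₂ → Progress N Fs₂
  glueDirectly {N} c d cs e f fs Fs refl refl (oddCover (v₁ ∷ v₂ ∷ vs) ps) = progress
    {family = (c′ ∷ cs) ∷ (e′ ∷ fs) ∷ Fs}
    (oddCover
      ( Valid-resp-↭ (c ∷ d ∷ cs) (c′ ∷ cs) (vertices-glue-flip c [] d (support cs)) v₁
      ∷ Valid-resp-↭ (e ∷ f ∷ fs) (e′ ∷ fs) (vertices-glue-flip e [] f (support fs)) v₂
      ∷ vs)
      (λ u v → trans (same-parity u v) (ps u v)))
    -- Each of the two forests loses a component; one loss already gives the strict decrease, and
    -- `ℕ.n≤1+n` absorbs the other.
    refl (s≤s (s≤s (ℕ.+-monoʳ-≤ (length cs) (ℕ.n≤1+n _)))) ℕ.≤-refl (λ _ → refl)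
    where
    c′ = glue (flip c) [] d
    e′ = glue (flip e) [] f
    same-parity : ∀ u v →
      totalParity u v ((c′ ∷ cs) ∷ (e′ ∷ fs) ∷ Fs)
        ≡ totalParity u v ((c ∷ d ∷ cs) ∷ (e ∷ f ∷ fs) ∷ Fs)
    same-parity u v = trans
      (cong₂ _xor_ (parity-glue-flip c [] d cs u v)
                   (cong (_xor totalParity u v Fs) (parity-glue-flip e [] f fs u v)))
      (xor-cancel₂ (edge (start c) (start d) u v) (parity u v (c ∷ d ∷ cs)) (parity u v (e ∷ f ∷ fs))
                   (totalParity u v Fs))

  odd-elsewhere : ∀ v F Fs → n ≤ N → OddCover N (F ∷ Fs) → endParity v F ≡ true →
                  ⨁ (endParity v) Fs ≡ true
  odd-elsewhere v F Fs n≤N good odd = xor-false-true odd (endParities-even n≤N good v)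
    where
    xor-false-true : ∀ {x y} → x ≡ true → x xor y ≡ false → y ≡ true
    xor-false-true {y = true} refl refl = refl

  glueThroughFreshIn : ∀ c d cs e es Fs → start e ≡ start c →
    OddCover N ((c ∷ d ∷ cs) ∷ (e ∷ es) ∷ Fs) → EndIn (start d) Fs →
    Progress N ((c ∷ d ∷ cs) ∷ (e ∷ es) ∷ Fs)
  glueThroughFreshIn c d cs e es Fs e≡c good (f , fs , Fs′ , p , f≡d) =
    Progress-≃ q (glueThroughFresh c d cs e es f fs Fs′ e≡c f≡d (OddCover-≃ q good))
    where q = under (c ∷ d ∷ cs) (under (e ∷ es) p)

  -- The start of `d` is an end in an odd number of the other forests. If the second forest is not
  -- among them, a third one is, and the new vertex can be used.
  glueOrShare : ∀ c d cs e es Fs → start e ≡ start c → n ≤ N →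
    OddCover N ((c ∷ d ∷ cs) ∷ (e ∷ es) ∷ Fs) →
    Progress N ((c ∷ d ∷ cs) ∷ (e ∷ es) ∷ Fs) ⊎ endParity (start d) (e ∷ es) ≡ true
  glueOrShare c d cs e es Fs e≡c n≤N good@(oddCover (v₁ ∷ _) _) = decide _ refl
    where
    b = start d
    odd : endParity b (e ∷ es) xor ⨁ (endParity b) Fs ≡ true
    odd = odd-elsewhere b (c ∷ d ∷ cs) ((e ∷ es) ∷ Fs) n≤N good
      -- `endParity-start` concerns the first chain of a forest, so `d` is moved in front of `c`, in
      -- the sum and in the uniqueness proof.
      (trans (xor-left-comm (ends b c) (ends b d) (endParity b cs))
             (endParity-start d (c ∷ cs) (unique-swap c d cs (unique v₁))))
    decide : ∀ p → endParity b (e ∷ es) ≡ p →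
             Progress _ ((c ∷ d ∷ cs) ∷ (e ∷ es) ∷ Fs) ⊎ endParity b (e ∷ es) ≡ true
    decide true  shared = inj₂ shared
    decide false alone  = inj₁ (glueThroughFreshIn c d cs e es Fs e≡c good
      (exposeEndInFamily b Fs (trans (cong (_xor ⨁ (endParity b) Fs) (sym alone)) odd)))

  -- Since `e` starts at `start c` and does not end at `start d`, the chain of the second forest
  -- that ends at `start d` is another one, and the direct edge is admissible.
  glueShared : ∀ c d cs e es Fs → start e ≡ start c → end e ≢ start d →
    endParity (start d) (e ∷ es) ≡ true →
    OddCover N ((c ∷ d ∷ cs) ∷ (e ∷ es) ∷ Fs) → Progress N ((c ∷ d ∷ cs) ∷ (e ∷ es) ∷ Fs)
  glueShared c d cs e es Fs e≡c e≢d shared good@(oddCover (v₁ ∷ _) _) =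
    gluePartner (exposeEnd b es (trans (sym (cong (_xor endParity b es) e-avoids-b)) shared))
    where
    b = start d
    e-avoids-b : ends b e ≡ false
    e-avoids-b = cong₂ _xor_
      (≢⇒≡ᵇ-false (start≢start c d cs (unique v₁) ∘ trans (sym e≡c))) (≢⇒≡ᵇ-false e≢d)
    gluePartner : (Σ Chain λ f → Σ Forest λ fs → es ≈ f ∷ fs × start f ≡ b) →
                  Progress _ ((c ∷ d ∷ cs) ∷ (e ∷ es) ∷ Fs)
    gluePartner (f , fs , p , f≡d) =
      Progress-≃ q (glueDirectly c d cs e f fs Fs e≡c f≡d (OddCover-≃ q good))
      where q = under (c ∷ d ∷ cs) (replace {xs = Fs} (under e p))

  -- Both ends of `d` are tried. If both are shared with the second forest, `e` has only one end
  -- left besides `start c`, so it misses one of them.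
  mergeAtPartner : ∀ c d cs e es Fs → start e ≡ start c → n ≤ N →
    OddCover N ((c ∷ d ∷ cs) ∷ (e ∷ es) ∷ Fs) → Progress N ((c ∷ d ∷ cs) ∷ (e ∷ es) ∷ Fs)
  mergeAtPartner {N} c d cs e es Fs e≡c n≤N good@(oddCover (v₁ ∷ _) _) =
    choose (glueOrShare c d cs e es Fs e≡c n≤N good)
           (glueOrShare c (flip d) cs e es Fs e≡c n≤N good′)
    where
    flipping : (c ∷ d ∷ cs) ∷ (e ∷ es) ∷ Fs ≃ (c ∷ flip d ∷ cs) ∷ (e ∷ es) ∷ Fs
    flipping = flipSecond c d cs ((e ∷ es) ∷ Fs)
    good′ = OddCover-≃ flipping good
    choose :
      Progress N ((c ∷ d ∷ cs) ∷ (e ∷ es) ∷ Fs) ⊎ endParity (start d) (e ∷ es) ≡ true →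
      Progress N ((c ∷ flip d ∷ cs) ∷ (e ∷ es) ∷ Fs) ⊎ endParity (end d) (e ∷ es) ≡ true →
      Progress N ((c ∷ d ∷ cs) ∷ (e ∷ es) ∷ Fs)
    choose (inj₁ done)   _             = done
    choose (inj₂ _)      (inj₁ done)   = Progress-≃ flipping done
    choose (inj₂ shared) (inj₂ shared′) with end e ≟ start d
    ... | no  e≢d = glueShared c d cs e es Fs e≡c e≢d shared good
    -- Now `e` ends at the start of `d`, hence not at its end, and the reversed `d` serves.
    ... | yes e≡d = Progress-≃ flipping
      (glueShared c (flip d) cs e es Fs e≡c
        (start≢end d (c ∷ cs) (unique-swap c d cs (unique v₁)) ∘ trans (sym e≡d)) shared′ good′)

  -- Evenness yields another forest in which `start c` is an end; it is moved into second place.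
  merge : ∀ c d cs Fs → n ≤ N → OddCover N ((c ∷ d ∷ cs) ∷ Fs) → Progress N ((c ∷ d ∷ cs) ∷ Fs)
  merge c d cs Fs n≤N good@(oddCover (v₁ ∷ _) _) =
    mergePartner (exposeEndInFamily (start c) Fs
      (odd-elsewhere (start c) (c ∷ d ∷ cs) Fs n≤N good (endParity-start c (d ∷ cs) (unique v₁))))
    where
    mergePartner : EndIn (start c) Fs → Progress _ ((c ∷ d ∷ cs) ∷ Fs)
    mergePartner (e , es , Fs′ , p , e≡c) =
      Progress-≃ q (mergeAtPartner c d cs e es Fs′ e≡c n≤N (OddCover-≃ q good))
      where q = under (c ∷ d ∷ cs) p

  findMergeable : ∀ Fs → All (λ F → length F ≤ 1) Fs ⊎
    Σ Chain λ c → Σ Chain λ d → Σ Forest λ cs → Σ Family λ Fs′ → Fs ↭ (c ∷ d ∷ cs) ∷ Fs′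
  findMergeable [] = inj₁ []
  findMergeable ((c ∷ d ∷ cs) ∷ Fs) = inj₂ (c , d , cs , Fs , Perm.refl)
  findMergeable ([] ∷ Fs) with findMergeable Fs
  ... | inj₁ short = inj₁ (z≤n ∷ short)
  ... | inj₂ (c , d , cs , Fs′ , p) =
    inj₂ (c , d , cs , [] ∷ Fs′ , ↭-trans (prep [] p) (Perm.swap _ _ Perm.refl))
  findMergeable ((e ∷ []) ∷ Fs) with findMergeable Fs
  ... | inj₁ short = inj₁ (s≤s z≤n ∷ short)
  ... | inj₂ (c , d , cs , Fs′ , p) =
    inj₂ (c , d , cs , (e ∷ []) ∷ Fs′ , ↭-trans (prep _ p) (Perm.swap _ _ Perm.refl))

  record Merged (N : ℕ) (Fs : Family) : Set where
    constructor merged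
    field
      {bound}     : ℕ
      {family}    : Family
      cover       : OddCover bound family
      paths       : All (λ F → length F ≤ 1) family
      same-length : length family ≡ length Fs
      bound-≤     : N ≤ bound
      bound-≡     : length Fs ≤ 2 → bound ≡ N

  -- The number `s` exceeds the number of components and makes the recursion structural.
  mergeAll : ∀ s {Fs} → size Fs < s → n ≤ N → OddCover N Fs → Merged N Fs
  mergeAll (suc s) {Fs} (s≤s size≤s) n≤N good with findMergeable Fs
  ... | inj₁ short = merged good short refl ℕ.≤-refl (λ _ → refl)
  ... | inj₂ (c , d , cs , Fs′ , p)
    with progress good′ l d b b≡ ← Progress-≃ (permute p) (merge c d cs Fs′ n≤N (OddCover-≃ (permute p) good))
    with merged good″ ps l′ b′ b′≡ ← mergeAll s (ℕ.<-≤-trans d size≤s) (ℕ.≤-trans n≤N b) good′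
    = merged good″ ps (trans l′ l) (ℕ.≤-trans b b′)
        (λ le → trans (b′≡ (subst (_≤ 2) (sym l) le)) (b≡ le))

-- Paths and chains

odd-length-filterᵇ : (p : A → Bool) → ∀ xs → oddᵇ (length (filterᵇ p xs)) ≡ ⨁ p xs
odd-length-filterᵇ p []       = refl
odd-length-filterᵇ p (x ∷ xs) with p x
... | false = odd-length-filterᵇ p xs
... | true  = trans (if-false-true _) (cong not (odd-length-filterᵇ p xs))
  where
  if-false-true : ∀ b → (if b then false else true) ≡ not b
  if-false-true true  = refl
  if-false-true false = refl

2∣⇒¬odd : ∀ {d} → 2 ∣ d → oddᵇ d ≡ false
2∣⇒¬odd (divides q refl) = double-even q
  where
  double-even : ∀ q → oddᵇ (q * 2) ≡ false
  double-even zero    = refl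
  double-even (suc q) rewrite double-even q = refl

linked : Fin n → Fin n → Fin n → Fin n → Bool
linked a b u v = (eqᵇ a u ∧ eqᵇ b v) ∨ (eqᵇ a v ∧ eqᵇ b u)

eqᵇ-true⇒≡ : (a b : Fin n) → eqᵇ a b ≡ true → a ≡ b
eqᵇ-true⇒≡ a b eq with a Fin.≟ b
... | yes a≡b = a≡b

eqᵇ-toℕ : (a b : Fin n) → eqᵇ a b ≡ (toℕ a ≡ᵇ toℕ b)
eqᵇ-toℕ zero    zero    = refl
eqᵇ-toℕ zero    (suc b) = refl
eqᵇ-toℕ (suc a) zero    = refl
eqᵇ-toℕ (suc a) (suc b) = eqᵇ-toℕ a b

∧-true : ∀ {x y} → x ∧ y ≡ true → x ≡ true × y ≡ true
∧-true {true} {true} _ = refl , refl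

∨-true : ∀ {x y} → x ∨ y ≡ true → x ≡ true ⊎ y ≡ true
∨-true {true}  _ = inj₁ refl
∨-true {false} y = inj₂ y

∨≡xor : ∀ {x y} → (x ≡ true → y ≡ true → ⊥) → x ∨ y ≡ x xor y
∨≡xor {false}        _    = refl
∨≡xor {true} {false} _    = refl
∨≡xor {true} {true}  both = ⊥-elim (both refl refl)

linked⇒≡ : (a b u v : Fin n) → linked a b u v ≡ true → (a ≡ u × b ≡ v) ⊎ (a ≡ v × b ≡ u)
linked⇒≡ a b u v l with ∨-true {eqᵇ a u ∧ eqᵇ b v} l
... | inj₁ uv = inj₁ (eqᵇ-true⇒≡ a u (proj₁ (∧-true uv)) , eqᵇ-true⇒≡ b v (proj₂ (∧-true {eqᵇ a u} uv)))
... | inj₂ vu = inj₂ (eqᵇ-true⇒≡ a v (proj₁ (∧-true vu)) , eqᵇ-true⇒≡ b u (proj₂ (∧-true {eqᵇ a v} vu)))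

uses⇒∈ : {u v : Fin n} → ∀ xs → usesEdgeL u v xs ≡ true → u ∈ xs × v ∈ xs
uses⇒∈ {u = u} {v} (a ∷ b ∷ xs) uses with ∨-true {linked a b u v} uses | uses⇒∈ {u = u} {v} (b ∷ xs)
... | inj₂ later | later⇒∈ = there (proj₁ (later⇒∈ later)) , there (proj₂ (later⇒∈ later))
... | inj₁ now   | _ with linked⇒≡ a b u v now
...   | inj₁ (refl , refl) = here refl , there (here refl)
...   | inj₂ (refl , refl) = there (here refl) , here refl

linked-toℕ : {a b : Fin n} → a ≢ b → ∀ u v → linked a b u v ≡ edge (toℕ a) (toℕ b) (toℕ u) (toℕ v)
linked-toℕ {a = a} {b} a≢b u v
  rewrite sym (eqᵇ-toℕ a u) | sym (eqᵇ-toℕ b v) | sym (eqᵇ-toℕ a v) | sym (eqᵇ-toℕ b u) =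
  ∨≡xor λ uv vu → a≢b (trans (eqᵇ-true⇒≡ a u (proj₁ (∧-true {eqᵇ a u} uv)))
                             (sym (eqᵇ-true⇒≡ b u (proj₂ (∧-true {eqᵇ a v} vu)))))

trail : List ℕ → ℕ → ℕ → Bool
trail (a ∷ b ∷ xs) u v = edge a b u v xor trail (b ∷ xs) u v
trail _            u v = false

-- Disjunction and `xor` agree because the first vertex does not recur, so no later step can use the
-- first edge again.
uses≡trail : {xs : List (Fin n)} → Unique xs → ∀ u v →
             usesEdgeL u v xs ≡ trail (map toℕ xs) (toℕ u) (toℕ v)
uses≡trail {xs = []}         _             u v = refl
uses≡trail {xs = a ∷ []}     _             u v = refl
uses≡trail {xs = a ∷ b ∷ xs} (a∉ ∷ unique) u v =
  trans (∨≡xor not-both)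
        (cong₂ _xor_ (linked-toℕ (All.lookup a∉ (here refl)) u v) (uses≡trail unique u v))
  where
  not-both : linked a b u v ≡ true → usesEdgeL u v (b ∷ xs) ≡ true → ⊥
  not-both now later with linked⇒≡ a b u v now
  ... | inj₁ (refl , _) = All.lookup a∉ (proj₁ (uses⇒∈ (b ∷ xs) later)) refl
  ... | inj₂ (refl , _) = All.lookup a∉ (proj₂ (uses⇒∈ (b ∷ xs) later)) refl

trail-vertices : ∀ a m b u v → trail (a ∷ m ++ [ b ]) u v ≡ walk a m b u v
trail-vertices a []      b u v = Bool.xor-identityʳ _
trail-vertices a (x ∷ m) b u v = cong (edge a x u v xor_) (trail-vertices x m b u v)

chainOf : ℕ → ℕ → List ℕ → Chain
chainOf a b []       = a ⟨ [] ⟩ b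
chainOf a b (x ∷ xs) = extend a (chainOf b x xs)

vertices-chainOf : ∀ a b xs → vertices (chainOf a b xs) ≡ a ∷ b ∷ xs
vertices-chainOf a b []       = refl
vertices-chainOf a b (x ∷ xs) = cong (a ∷_) (vertices-chainOf b x xs)

covers-chainOf : ∀ a b xs u v → covers (chainOf a b xs) u v ≡ trail (a ∷ b ∷ xs) u v
covers-chainOf a b xs u v =
  trans (sym (trail-vertices _ (inner (chainOf a b xs)) _ u v))
        (cong (λ l → trail l u v) (vertices-chainOf a b xs))

-- Lists with fewer than two vertices carry no edge and are dropped, which is why `support-forestOf`
-- gives only a sublist.
forestOf : List (List ℕ) → Forest
forestOf []                   = []
forestOf ((a ∷ b ∷ xs) ∷ xss) = chainOf a b xs ∷ forestOf xss
forestOf (_            ∷ xss) = forestOf xss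

support-forestOf : ∀ xss → support (forestOf xss) ⊆ concat xss
support-forestOf []                   = []
support-forestOf ([] ∷ xss)           = support-forestOf xss
support-forestOf ((a ∷ []) ∷ xss)     = a ∷ʳ support-forestOf xss
support-forestOf ((a ∷ b ∷ xs) ∷ xss) =
  Sublist.++⁺ (subst (_⊆ a ∷ b ∷ xs) (sym (vertices-chainOf a b xs)) ⊆-refl) (support-forestOf xss)

parity-forestOf : ∀ u v xss → parity u v (forestOf xss) ≡ ⨁ (λ xs → trail xs u v) xss
parity-forestOf u v []                   = refl
parity-forestOf u v ([] ∷ xss)           = parity-forestOf u v xss
parity-forestOf u v ((a ∷ []) ∷ xss)     = parity-forestOf u v xss
parity-forestOf u v ((a ∷ b ∷ xs) ∷ xss) =
  cong₂ _xor_ (covers-chainOf a b xs u v) (parity-forestOf u v xss)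

Unique-resp-⊆ : {xs ys : List A} → xs ⊆ ys → Unique ys → Unique xs
Unique-resp-⊆ []         []         = []
Unique-resp-⊆ (y ∷ʳ p)   (_ ∷ un)   = Unique-resp-⊆ p un
Unique-resp-⊆ (refl ∷ p) (y∉ ∷ un)  = Sublist.All-resp-⊆ p y∉ ∷ Unique-resp-⊆ p un

Valid-forestOf : (xss : List (List (Fin n))) → Unique (concat xss) →
                 Valid n (forestOf (map (map toℕ) xss))
Valid-forestOf {n} xss un = valid
  (Unique-resp-⊆ below (Unique.map⁺ Fin.toℕ-injective un))
  (Sublist.All-resp-⊆ below (All.map⁺ (All.universal Fin.toℕ<n (concat xss))))
  where
  below : support (forestOf (map (map toℕ) xss)) ⊆ map toℕ (concat xss)
  below = subst (support (forestOf (map (map toℕ) xss)) ⊆_) (List.concat-map xss) (support-forestOf (map (map toℕ) xss))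

walk-diagonal : ∀ a m b u → walk a m b u u ≡ false
walk-diagonal a []      b u = Bool.xor-same ((a ≡ᵇ u) ∧ (b ≡ᵇ u))
walk-diagonal a (x ∷ m) b u =
  cong₂ _xor_ (Bool.xor-same ((a ≡ᵇ u) ∧ (x ≡ᵇ u))) (walk-diagonal x m b u)

⨁-false : {f : A → Bool} → ∀ {xs} → All (λ x → f x ≡ false) xs → ⨁ f xs ≡ false
⨁-false []         = refl
⨁-false (fx ∷ fxs) = cong₂ _xor_ fx (⨁-false fxs)

⨁-map : {B : Set} (f : B → Bool) (h : A → B) → ∀ xs → ⨁ f (map h xs) ≡ ⨁ (f ∘ h) xs
⨁-map f h []       = refl
⨁-map f h (x ∷ xs) = cong (f (h x) xor_) (⨁-map f h xs)

totalParity-diagonal : ∀ u Fs → totalParity u u Fs ≡ false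
totalParity-diagonal u Fs =
  ⨁-false (All.universal (λ F → ⨁-false (All.universal (λ c → walk-diagonal (start c) (inner c) (end c) u) F)) Fs)

totalParity-sym : ∀ u v Fs → totalParity u v Fs ≡ totalParity v u Fs
totalParity-sym u v = ⨁-cong (parity-sym u v)

totalParity-beyond : ∀ {u} v {Fs} → N ≤ u → All (Valid N) Fs → totalParity u v Fs ≡ false
totalParity-beyond v N≤u vs =
  ⨁-false (All.map (λ {F} w → parity-∉ v F (All.map (λ x<N → ℕ.<⇒≢ (ℕ.<-≤-trans x<N N≤u)) (bounded w))) vs)

-- Linear forests as forests of chains

componentLists : LinearForest n → List (List (Fin n))
componentLists F = map verts (comps F)

Unique-components : (F : LinearForest n) → Unique (concat (componentLists F))
Unique-components F = Unique.concat⁺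
  (All.map⁺ (All.universal distinct (comps F)))
  (AllPairs.map⁺ (AllPairs.map (λ {p} {q} dis {x} (x∈p , x∈q) → dis x x∈p x∈q) (disjoint F)))

chainForest : LinearForest n → Forest
chainForest F = forestOf (map (map toℕ) (componentLists F))

parity-chainForest : ∀ u v (F : LinearForest n) →
  parity (toℕ u) (toℕ v) (chainForest F) ≡ ⨁ (usesEdge u v) (comps F)
parity-chainForest u v F = begin
  parity (toℕ u) (toℕ v) (chainForest F)
    ≡⟨ parity-forestOf (toℕ u) (toℕ v) (map (map toℕ) (componentLists F)) ⟩
  ⨁ t (map (map toℕ) (map verts (comps F)))
    ≡⟨ ⨁-map t (map toℕ) (map verts (comps F)) ⟩
  ⨁ (t ∘ map toℕ) (map verts (comps F))
    ≡⟨ ⨁-map (t ∘ map toℕ) verts (comps F) ⟩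
  ⨁ (t ∘ map toℕ ∘ verts) (comps F)
    ≡⟨ ⨁-cong (λ p → uses≡trail (distinct p) u v) (comps F) ⟨
  ⨁ (usesEdge u v) (comps F) ∎
  where
  open ≡-Reasoning
  t : List ℕ → Bool
  t xs = trail xs (toℕ u) (toℕ v)

chainFamily : List (LinearForest n) → Family
chainFamily = map chainForest

totalParity-chainFamily : ∀ u v (fs : List (LinearForest n)) →
  totalParity (toℕ u) (toℕ v) (chainFamily fs) ≡ ⨁ (usesEdge u v) (concat (map comps fs))
totalParity-chainFamily u v []       = refl
totalParity-chainFamily u v (F ∷ fs) =
  trans (cong₂ _xor_ (parity-chainForest u v F) (totalParity-chainFamily u v fs))
        (sym (⨁-++ (usesEdge u v) (comps F) _))

⨁-tabulate : (p : A → Bool) (f : Fin n → A) (h : ℕ → Bool) → (∀ i → h (toℕ i) ≡ p (f i)) →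
             ⨁< n h ≡ ⨁ p (tabulate f)
⨁-tabulate {n = zero}  p f h h≗p = refl
⨁-tabulate {n = suc n} p f h h≗p =
  cong₂ _xor_ (h≗p zero) (⨁-tabulate p (f ∘ suc) (h ∘ suc) (h≗p ∘ suc))

liftBounded : ∀ {xs} → All (_< N) xs → Σ (List (Fin N)) λ ys → map toℕ ys ≡ xs
liftBounded []           = [] , refl
liftBounded (x<N ∷ xs<N) with ys , eq ← liftBounded xs<N =
  fromℕ< x<N ∷ ys , cong₂ _∷_ (Fin.toℕ-fromℕ< x<N) eq

trail-support : ∀ u v F → length F ≤ 1 → trail (support F) u v ≡ parity u v F
trail-support u v []       _ = refl
trail-support u v (c ∷ []) _ =
  trans (cong (λ l → trail l u v) (List.++-identityʳ (vertices c)))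
        (trans (trail-vertices (start c) (inner c) (end c) u v) (sym (Bool.xor-identityʳ _)))
trail-support u v (_ ∷ _ ∷ _) (s≤s ())

-- An empty forest becomes the path without vertices, so there are as many paths as forests.
toPath : ∀ F → Valid N F → length F ≤ 1 →
         Σ (Path N) λ p → ∀ u v → usesEdge u v p ≡ parity (toℕ u) (toℕ v) F
toPath F (valid un bd) short with ys , eq ← liftBounded bd =
  mkPath ys unique-ys , λ u v → trans (uses≡trail unique-ys u v)
    (trans (cong (λ l → trail l (toℕ u) (toℕ v)) eq) (trail-support (toℕ u) (toℕ v) F short))
  where
  unique-ys : Unique ys
  unique-ys = Unique.map⁻ (subst Unique (sym eq) un)

toPaths : ∀ {Fs} → All (Valid N) Fs → All (λ F → length F ≤ 1) Fs →
          Σ (List (Path N)) λ ps → length ps ≡ length Fs ×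
            (∀ u v → ⨁ (usesEdge u v) ps ≡ totalParity (toℕ u) (toℕ v) Fs)
toPaths []               []               = [] , refl , λ _ _ → refl
toPaths (_∷_ {x = F} w ws) (short ∷ shorts)
  with p , eq ← toPath F w short | ps , len , eqs ← toPaths ws shorts =
  p ∷ ps , cong suc len , λ u v → cong₂ _xor_ (eq u v) (eqs u v)

-- From a linear forest decomposition to a path odd-cover

module _ (G : Graph n) (euler : Eulerian G) (fs : List (LinearForest n))
         (decomp : ∀ u v → u ≢ v → edgeMult u v (concat (map comps fs)) ≡ (if adj G u v then 1 else 0)) where

  private
    -- The target is read off from the given forests instead of from `adj`: it is then defined on
    -- all natural numbers, and the initial family covers it by `refl`.
    g : ℕ → ℕ → Bool
    g u v = totalParity u v (chainFamily fs)

    valids : All (Valid n) (chainFamily fs)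
    valids = All.map⁺ (All.universal (λ F → Valid-forestOf (componentLists F) (Unique-components F)) fs)

    g≡adj : ∀ x y → g (toℕ x) (toℕ y) ≡ adj G x y
    g≡adj x y with x Fin.≟ y
    ... | yes refl = trans (totalParity-diagonal (toℕ x) (chainFamily fs)) (sym (irref G x))
    ... | no  x≢y  = begin
      g (toℕ x) (toℕ y)                               ≡⟨ totalParity-chainFamily x y fs ⟩
      ⨁ (usesEdge x y) (concat (map comps fs))        ≡⟨ odd-length-filterᵇ (usesEdge x y) (concat (map comps fs)) ⟨
      oddᵇ (edgeMult x y (concat (map comps fs)))     ≡⟨ cong oddᵇ (decomp x y x≢y) ⟩
      oddᵇ (if adj G x y then 1 else 0)               ≡⟨ odd-indicator (adj G x y) ⟩
      adj G x y                                       ∎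
      where
      open ≡-Reasoning
      odd-indicator : ∀ b → oddᵇ (if b then 1 else 0) ≡ b
      odd-indicator true  = refl
      odd-indicator false = refl

    g-beyond : ∀ {u} v → n ≤ u → g u v ≡ false
    g-beyond v n≤u = totalParity-beyond v n≤u valids

    g-beyond′ : ∀ u {v} → n ≤ v → g u v ≡ false
    g-beyond′ u {v} n≤v = trans (totalParity-sym u v (chainFamily fs)) (g-beyond u n≤v)

    g-even-at : ∀ y → ⨁< n (λ u → g u (toℕ y)) ≡ false
    g-even-at y = begin
      ⨁< n (λ u → g u (toℕ y))   ≡⟨ ⨁-tabulate (adj G y) (λ i → i) _ (λ i → trans (g≡adj i y) (adj-sym G i y)) ⟩
      ⨁ (adj G y) (allFin n)     ≡⟨ odd-length-filterᵇ (adj G y) (allFin n) ⟨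
      oddᵇ (degree G y)          ≡⟨ 2∣⇒¬odd (euler y) ⟩
      false                      ∎
      where open ≡-Reasoning

    -- A vertex from `n` on is isolated; for an older one the terms from `n` on vanish, and what
    -- remains is its degree in `G`.
    g-even : ∀ {N} → n ≤ N → ∀ v → ⨁< N (λ u → g u v) ≡ false
    g-even {N} n≤N v with n ≤? v
    ... | yes n≤v = trans (⨁<-cong N (λ u → g-beyond′ u n≤v)) (⨁<-false N)
    ... | no  n≰v = trans (⨁<-support (λ u → g u v) n≤N (λ u n≤u → g-beyond v n≤u))
      (subst (λ w → ⨁< n (λ u → g u w) ≡ false) (Fin.toℕ-fromℕ< (ℕ.≰⇒> n≰v)) (g-even-at _))

    open Merging g n g-even

    result : Merged n (chainFamily fs)
    result = mergeAll (suc (size (chainFamily fs))) ℕ.≤-refl ℕ.≤-refl (oddCover valids (λ _ _ → refl))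

    -- Phrased through `toℕ`, so that a cover can be transported along an equation between vertex
    -- bounds.
    CoverOn : ℕ → Set
    CoverOn N = Σ (List (Path N)) λ ps → length ps ≡ length fs ×
                  (∀ u v → oddᵇ (edgeMult u v ps) ≡ g (toℕ u) (toℕ v))

    open Merged

    covering : CoverOn (bound result)
    covering with ps , len , eq ← toPaths (OddCover.valids (cover result)) (paths result) =
      ps , trans len (trans (same-length result) (List.length-map chainForest fs)) ,
      λ u v → trans (odd-length-filterᵇ (usesEdge u v) ps) (trans (eq u v) (OddCover.parities (cover result) (toℕ u) (toℕ v)))

    toℕ-old : ∀ m {i : Fin (n + m)} {x} → Fin.splitAt n i ≡ inj₁ x → toℕ i ≡ toℕ x
    toℕ-old m eq = trans (cong toℕ (sym (Fin.splitAt⁻¹-↑ˡ eq))) (Fin.toℕ-↑ˡ _ m)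

    toℕ-new : ∀ m {i : Fin (n + m)} {y} → Fin.splitAt n i ≡ inj₂ y → n ≤ toℕ i
    toℕ-new m eq =
      subst (n ≤_) (trans (sym (Fin.toℕ-↑ʳ n _)) (cong toℕ (Fin.splitAt⁻¹-↑ʳ eq))) (ℕ.m≤m+n n _)

    g-addIsolated : ∀ m u v → g (toℕ u) (toℕ v) ≡ adj (addIsolated G m) u v
    g-addIsolated m u v with Fin.splitAt n u in eu | Fin.splitAt n v in ev
    ... | inj₁ x | inj₁ y = trans (cong₂ g (toℕ-old m eu) (toℕ-old m ev)) (g≡adj x y)
    ... | inj₁ _ | inj₂ _ = g-beyond′ (toℕ u) (toℕ-new m ev)
    ... | inj₂ _ | inj₁ _ = g-beyond (toℕ v) (toℕ-new m eu)
    ... | inj₂ _ | inj₂ _ = g-beyond (toℕ v) (toℕ-new m eu)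

  coverWithIsolated : ∃ λ m → HasPathOddCoverOfSize (addIsolated G m) (length fs)
  coverWithIsolated = m , toAddIsolated (subst CoverOn (sym (ℕ.m+[n∸m]≡n (bound-≤ result))) covering)
    where
    -- The isolated vertices to be added are those created during the merging.
    m = bound result ∸ n
    toAddIsolated : CoverOn (n + m) → HasPathOddCoverOfSize (addIsolated G m) (length fs)
    toAddIsolated (ps , len , eq) = ps , len , λ u v _ → trans (eq u v) (g-addIsolated m u v)

  coverWithoutIsolated : length fs ≤ 2 → HasPathOddCoverOfSize G (length fs)
  coverWithoutIsolated le = toG (subst CoverOn (bound-≡ result (subst (_≤ 2) (sym (List.length-map chainForest fs)) le)) covering)
    where
    toG : CoverOn n → HasPathOddCoverOfSize G (length fs)
    toG (ps , len , eq) = ps , len , λ u v _ → trans (eq u v) (g≡adj u v)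

-- Cutting a path cover into linear forests

indicator : Bool → ℕ
indicator b = if b then 1 else 0

any-filterᵇ : (p : A → Bool) → ∀ xs → any p xs ≡ false → length (filterᵇ p xs) ≡ 0
any-filterᵇ p []       none = refl
any-filterᵇ p (x ∷ xs) none with p x
... | false = any-filterᵇ p xs none

any⇒∈-concat : ∀ {u v : Fin n} xss → any (usesEdgeL u v) xss ≡ true → u ∈ concat xss
any⇒∈-concat {u = u} {v} (xs ∷ xss) used with ∨-true {usesEdgeL u v xs} used
... | inj₁ here′  = ∈-++⁺ˡ (proj₁ (uses⇒∈ xs here′))
... | inj₂ there′ = ∈-++⁺ʳ xs (any⇒∈-concat xss there′)

Unique-++⁻ : (xs : List A) → ∀ {ys} → Unique (xs ++ ys) →
             Unique xs × Unique ys × (∀ {x} → x ∈ xs → x ∈ ys → ⊥)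
Unique-++⁻ []       un        = [] , un , λ ()
Unique-++⁻ (x ∷ xs) (x∉ ∷ un) with un-xs , un-ys , apart ← Unique-++⁻ xs un =
  All.++⁻ˡ xs x∉ ∷ un-xs , un-ys , λ
    { (here refl) x∈ys → All.lookup (All.++⁻ʳ xs x∉) x∈ys refl
    ; (there x∈xs) x∈ys → apart x∈xs x∈ys }

-- The field `lists` lets the recursion transfer disjointness from the lists to the components built
-- so far.
record ForestFor {n} (xss : List (List (Fin n))) : Set where
  constructor forestFor
  field
    forest     : LinearForest n
    lists      : map verts (comps forest) ≡ xss
    edgeCounts : ∀ u v → edgeMult u v (comps forest) ≡ indicator (any (usesEdgeL u v) xss)
open ForestFor

linearForest : (xss : List (List (Fin n))) → Unique (concat xss) → ForestFor xss
linearForest []         un = forestFor (mkLF [] []) refl (λ _ _ → refl)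
linearForest (xs ∷ xss) un with un-xs , un-xss , apart ← Unique-++⁻ xs un =
  forestFor (mkLF (p ∷ comps F) (apart-from-F ∷ disjoint F)) (cong (xs ∷_) (lists rec)) counts
  where
  rec = linearForest xss un-xss
  F   = forest rec
  p   = mkPath xs un-xs
  apart-from-F : All (VertexDisjoint p) (comps F)
  apart-from-F = All.map⁻ (subst (All (λ ys → ∀ x → x ∈ xs → ¬ x ∈ ys)) (sym (lists rec))
    (All.tabulate λ ys∈xss x x∈xs x∈ys → apart x∈xs (∈-concat⁺′ x∈ys ys∈xss)))
  counts : ∀ u v → edgeMult u v (p ∷ comps F) ≡ indicator (any (usesEdgeL u v) (xs ∷ xss))
  counts u v with usesEdgeL u v xs in used
  ... | false = edgeCounts rec u v
  ... | true  with any (usesEdgeL u v) xss in used-later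
  -- An edge in two of the lists would put `u` in both.
  ...   | true  = ⊥-elim (apart (proj₁ (uses⇒∈ xs used)) (any⇒∈-concat xss used-later))
  ...   | false = cong suc (trans (edgeCounts rec u v) (cong indicator used-later))

-- The first component of the pair is the piece still being extended at its front; it is empty just
-- after a vertex outside the graph, which is represented by nothing.
attach : (Fin n → Fin n → Bool) → Fin n → List (Fin n) × List (List (Fin n)) →
         List (Fin n) × List (List (Fin n))
attach keep a ([]     , xss) = [ a ] , xss
attach keep a (b ∷ xs , xss) = if keep a b then (a ∷ b ∷ xs , xss) else ([ a ] , (b ∷ xs) ∷ xss)

pieces : (Fin n → Fin n → Bool) → List (Maybe (Fin n)) → List (Fin n) × List (List (Fin n))
pieces keep []             = [] , []
pieces keep (nothing ∷ xs) = [] , proj₁ (pieces keep xs) ∷ proj₂ (pieces keep xs)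
pieces keep (just a ∷ xs)  = attach keep a (pieces keep xs)

allPieces : List A × List (List A) → List (List A)
allPieces (xs , xss) = xs ∷ xss

concat-attach : ∀ keep (a : Fin n) ps → concat (allPieces (attach keep a ps)) ≡ a ∷ concat (allPieces ps)
concat-attach keep a ([]     , xss) = refl
concat-attach keep a (b ∷ xs , xss) with keep a b
... | true  = refl
... | false = refl

concat-pieces : ∀ keep (xs : List (Maybe (Fin n))) → concat (allPieces (pieces keep xs)) ≡ catMaybes xs
concat-pieces keep []             = refl
concat-pieces keep (nothing ∷ xs) = concat-pieces keep xs
concat-pieces keep (just a ∷ xs)  =
  trans (concat-attach keep a (pieces keep xs)) (cong (a ∷_) (concat-pieces keep xs))

-- A gap left by an outside vertex separates its neighbours: they do not count as consecutive.
usesEdgeM : Fin n → Fin n → List (Maybe (Fin n)) → Bool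
usesEdgeM u v (just a ∷ just b ∷ xs) = linked a b u v ∨ usesEdgeM u v (just b ∷ xs)
usesEdgeM u v (_ ∷ xs)               = usesEdgeM u v xs
usesEdgeM u v []                     = false

attach-head : ∀ keep (a : Fin n) ps → ∃ λ xs → proj₁ (attach keep a ps) ≡ a ∷ xs
attach-head keep a ([]     , xss) = [] , refl
attach-head keep a (b ∷ xs , xss) with keep a b
... | true  = b ∷ xs , refl
... | false = [] , refl

module _ (keep : Fin n → Fin n → Bool) (keep-sym : ∀ a b → keep a b ≡ keep b a) where

  linked-keep : ∀ a b u v → linked a b u v ≡ true → keep a b ≡ keep u v
  linked-keep a b u v l with linked⇒≡ a b u v l
  ... | inj₁ (refl , refl) = refl
  ... | inj₂ (refl , refl) = keep-sym a b

  attach-used : ∀ a b xs xss {u v r} → any (usesEdgeL u v) ((b ∷ xs) ∷ xss) ≡ r ∧ keep u v →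
    any (usesEdgeL u v) (allPieces (attach keep a (b ∷ xs , xss))) ≡ (linked a b u v ∨ r) ∧ keep u v
  attach-used a b xs xss {u} {v} {r} eq with keep a b in kept | linked a b u v in l
  ... | true  | true  rewrite l = trans (sym kept) (linked-keep a b u v l)
  ... | true  | false rewrite l = eq
  ... | false | false = eq
  -- The cut removes the edge `uv` itself; as `keep u v` is false, both sides are false.
  ... | false | true  with dropped ← trans (sym (linked-keep a b u v l)) kept =
    trans eq (trans (trans (cong (r ∧_) dropped) (Bool.∧-zeroʳ r)) (sym dropped))

  pieces-used : ∀ u v xs → any (usesEdgeL u v) (allPieces (pieces keep xs)) ≡ usesEdgeM u v xs ∧ keep u v
  pieces-used u v []                     = refl
  pieces-used u v (nothing ∷ xs)         = pieces-used u v xs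
  pieces-used u v (just a ∷ [])          = refl
  pieces-used u v (just a ∷ nothing ∷ xs) = pieces-used u v xs
  pieces-used u v (just a ∷ just b ∷ xs) with pieces-used u v (just b ∷ xs)
  -- The current piece begins with `b`, so `attach` tests exactly the edge from `a` to `b`.
  ... | ih with pieces keep (just b ∷ xs) | attach-head keep b (pieces keep xs)
  ...   | .b ∷ ys , xss | .ys , refl = attach-used a b ys xss ih

linked-sym : ∀ (a b u v : Fin n) → linked a b u v ≡ linked a b v u
linked-sym a b u v = Bool.∨-comm (eqᵇ a u ∧ eqᵇ b v) _

usesEdgeL-sym : ∀ (u v : Fin n) xs → usesEdgeL u v xs ≡ usesEdgeL v u xs
usesEdgeL-sym u v []           = refl
usesEdgeL-sym u v (a ∷ [])     = refl
usesEdgeL-sym u v (a ∷ b ∷ xs) = cong₂ _∨_ (linked-sym a b u v) (usesEdgeL-sym u v (b ∷ xs))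

any-cong : {p q : A → Bool} → (∀ x → p x ≡ q x) → ∀ xs → any p xs ≡ any q xs
any-cong p≗q []       = refl
any-cong p≗q (x ∷ xs) = cong₂ _∨_ (p≗q x) (any-cong p≗q xs)

-- The embedding `ι` and its partial inverse `ρ` treat the graph itself and its extensions by
-- isolated vertices together.
module Restriction {n N} (G : Graph n) (H : Graph N)
  (ι : Fin n → Fin N) (ρ : Fin N → Maybe (Fin n))
  (ρ∘ι : ∀ x → ρ (ι x) ≡ just x) (ρ-just : ∀ {y x} → ρ y ≡ just x → y ≡ ι x)
  (adj-ι : ∀ x y → adj H (ι x) (ι y) ≡ adj G x y) where

  Unique-restrict : ∀ {xs} → Unique xs → Unique (catMaybes (map ρ xs))
  Unique-restrict []                    = []
  Unique-restrict (_∷_ {x = y} {xs} y∉ un) with ρ y in ρy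
  ... | nothing = Unique-restrict un
  ... | just a  = avoid y∉ ∷ Unique-restrict un
    where
    avoid : ∀ {zs} → All (y ≢_) zs → All (a ≢_) (catMaybes (map ρ zs))
    avoid []                       = []
    avoid (_∷_ {x = z} y≢z y∉zs) with ρ z in ρz
    ... | nothing = avoid y∉zs
    ... | just b  = (λ { refl → y≢z (trans (ρ-just ρy) (sym (ρ-just ρz))) }) ∷ avoid y∉zs

  eqᵇ-ι : ∀ {y a} → ρ y ≡ just a → ∀ u → eqᵇ y (ι u) ≡ eqᵇ a u
  eqᵇ-ι {y} {a} ρy u with a Fin.≟ u
  ... | yes refl = dec-true (y Fin.≟ ι a) (ρ-just ρy)
  ... | no  a≢u  = dec-false (y Fin.≟ ι u) λ { refl → a≢u (just-injective (trans (sym ρy) (ρ∘ι u))) }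

  eqᵇ-ι-nothing : ∀ {y} → ρ y ≡ nothing → ∀ u → eqᵇ y (ι u) ≡ false
  eqᵇ-ι-nothing {y} ρy u = dec-false (y Fin.≟ ι u) λ { refl → nothing≢just (trans (sym ρy) (ρ∘ι u)) }
    where
    nothing≢just : ∀ {x : Fin n} → nothing ≢ just x
    nothing≢just ()

  usesEdge-ι : ∀ u v xs → usesEdgeL (ι u) (ι v) xs ≡ usesEdgeM u v (map ρ xs)
  usesEdge-ι u v []           = refl
  usesEdge-ι u v (x ∷ [])     with ρ x
  ... | nothing = refl
  ... | just a  = refl
  usesEdge-ι u v (x ∷ y ∷ xs) with ρ x in ρx | ρ y in ρy | usesEdge-ι u v (y ∷ xs)
  ... | nothing | _       | ih
    rewrite eqᵇ-ι-nothing ρx u | eqᵇ-ι-nothing ρx v = ih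
  ... | just a  | nothing | ih
    rewrite eqᵇ-ι-nothing ρy u | eqᵇ-ι-nothing ρy v
          | Bool.∧-zeroʳ (eqᵇ x (ι u)) | Bool.∧-zeroʳ (eqᵇ x (ι v)) = ih
  ... | just a  | just b  | ih
    rewrite eqᵇ-ι ρx u | eqᵇ-ι ρx v | eqᵇ-ι ρy u | eqᵇ-ι ρy v = cong (linked a b u v ∨_) ih

  used : Fin n → Fin n → List (Path N) → Bool
  used u v = any (usesEdge (ι u) (ι v))

  edgeMult-++ : ∀ (u v : Fin n) ps qs → edgeMult u v (ps ++ qs) ≡ edgeMult u v ps + edgeMult u v qs
  edgeMult-++ u v ps qs =
    trans (cong length (List.filter-++ (λ p → Bool.T? (usesEdge u v p)) ps qs)) (List.length-++ (filterᵇ (usesEdge u v) ps))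

  -- By recursion, each edge of `G` used by some remaining path is counted once: the first path
  -- keeps it only if no later path uses it, so the two counts added never overlap.
  decompose : (ps : List (Path N)) → Σ (Vec (LinearForest n) (length ps)) λ fs →
    ∀ u v → edgeMult u v (concat (map comps (toList fs))) ≡ indicator (adj G u v ∧ used u v ps)
  decompose []       = [] , λ u v → cong indicator (sym (Bool.∧-zeroʳ (adj G u v)))
  decompose (p ∷ ps) with fs , eq ← decompose ps =
    forest F ∷ fs , λ u v → begin
      edgeMult u v (comps (forest F) ++ concat (map comps (toList fs)))
        ≡⟨ edgeMult-++ u v (comps (forest F)) _ ⟩
      edgeMult u v (comps (forest F)) + edgeMult u v (concat (map comps (toList fs)))
        ≡⟨ cong₂ _+_ (edgeCounts F u v) (eq u v) ⟩
      indicator (any (usesEdgeL u v) (allPieces cut)) + indicator (adj G u v ∧ used u v ps)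
        ≡⟨ cong (λ b → indicator b + indicator (adj G u v ∧ used u v ps))
             (trans (pieces-used keep keep-sym u v (map ρ (verts p)))
                    (cong (_∧ keep u v) (sym (usesEdge-ι u v (verts p))))) ⟩
      indicator (usesEdge (ι u) (ι v) p ∧ keep u v) + indicator (adj G u v ∧ used u v ps)
        ≡⟨ split-indicator (usesEdge (ι u) (ι v) p) (adj G u v) (used u v ps) ⟩
      indicator (adj G u v ∧ (usesEdge (ι u) (ι v) p ∨ used u v ps)) ∎
    where
    open ≡-Reasoning
    keep : Fin n → Fin n → Bool
    keep u v = adj G u v ∧ not (used u v ps)
    keep-sym : ∀ u v → keep u v ≡ keep v u
    keep-sym u v = cong₂ (λ b c → b ∧ not c) (adj-sym G u v)
      (any-cong (λ q → usesEdgeL-sym (ι u) (ι v) (verts q)) ps)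
    cut = pieces keep (map ρ (verts p))
    F : ForestFor (allPieces cut)
    F = linearForest (allPieces cut)
      (subst Unique (sym (concat-pieces keep (map ρ (verts p)))) (Unique-restrict (distinct p)))
    split-indicator : ∀ x a y → indicator (x ∧ (a ∧ not y)) + indicator (a ∧ y) ≡ indicator (a ∧ (x ∨ y))
    split-indicator false a     y     = refl
    split-indicator true  false y     = refl
    split-indicator true  true  false = refl
    split-indicator true  true  true  = refl

  decomposition : ∀ {j} → HasPathOddCoverOfSize H j → HasLinearForestDecomposition G j
  decomposition (ps , refl , odd) with fs , eq ← decompose ps =
    fs , λ u v u≢v → trans (eq u v) (cong indicator (adj-used u v u≢v))
    where
    adj-used : ∀ u v → u ≢ v → adj G u v ∧ used u v ps ≡ adj G u v
    adj-used u v u≢v with used u v ps in none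
    ... | true  = Bool.∧-identityʳ _
    -- An edge used by no path has multiplicity 0, which is even, so the odd-cover condition makes
    -- it a non-edge.
    ... | false = trans (Bool.∧-zeroʳ (adj G u v))
      (trans (sym (cong oddᵇ (any-filterᵇ (usesEdge (ι u) (ι v)) ps none)))
        (trans (odd (ι u) (ι v) (u≢v ∘ ι-injective)) (adj-ι u v)))
      where
      ι-injective : ∀ {x y} → ι x ≡ ι y → x ≡ y
      ι-injective {x} {y} eq = just-injective (trans (sym (ρ∘ι x)) (trans (cong ρ eq) (ρ∘ι y)))

-- Lower bounds and conclusion

restrictDecomposition : ∀ (G : Graph n) {j} → HasPathOddCoverOfSize G j → HasLinearForestDecomposition G j
restrictDecomposition G = Restriction.decomposition G G (λ x → x) just (λ _ → refl) just-injective (λ _ _ → refl)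

restrictIsolated : ∀ (G : Graph n) m {j} →
  HasPathOddCoverOfSize (addIsolated G m) j → HasLinearForestDecomposition G j
restrictIsolated {n} G m = Restriction.decomposition G (addIsolated G m) (Fin._↑ˡ m) ρ ρ∘ι ρ-just adj-ι
  where
  ρ : Fin (n + m) → Maybe (Fin n)
  ρ y = isInj₁ (Fin.splitAt n y)
  ρ∘ι : ∀ x → ρ (x Fin.↑ˡ m) ≡ just x
  ρ∘ι x = cong isInj₁ (Fin.splitAt-↑ˡ n x m)
  ρ-just : ∀ {y x} → ρ y ≡ just x → y ≡ x Fin.↑ˡ m
  ρ-just {y} eq with Fin.splitAt n y in split
  ρ-just refl | inj₁ x = sym (Fin.splitAt⁻¹-↑ˡ split)
  adj-ι : ∀ x y → adj (addIsolated G m) (x Fin.↑ˡ m) (y Fin.↑ˡ m) ≡ adj G x y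
  adj-ι x y rewrite Fin.splitAt-↑ˡ n x m | Fin.splitAt-↑ˡ n y m = refl

theorem1p2 : ∀ {n} (G : Graph n) → Eulerian G → ∀ (k : ℕ) → LaIs G k →
    P2IsoIs G k × (k ≤ 2 → P2Is G k)
theorem1p2 G euler k ((fs , decomp) , minimal) =
  ( subst (λ j → ∃ λ m → HasPathOddCoverOfSize (addIsolated G m) j) (Vec.length-toList fs)
      (coverWithIsolated G euler (toList fs) decomp)
  -- Cutting keeps the count: `j` paths yield `j` linear forests, to which the minimality of `k`
  -- applies.
  , λ m j → minimal j ∘ restrictIsolated G m )
  , λ k≤2 →
    ( subst (HasPathOddCoverOfSize G) (Vec.length-toList fs)
        (coverWithoutIsolated G euler (toList fs) decomp (subst (_≤ 2) (sym (Vec.length-toList fs)) k≤2))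
    , λ j → minimal j ∘ restrictDecomposition G )
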